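{- Let $S$ be a string of length $n$ over the alphabet $[0,\sigma)$, and let $\mathcal{C}$ be its Cartesian tree. For any SLP grammar compression $\mathcal{S}$ of $S$ there is a top-tree compression $\mathcal{T}$ of $\mathcal{C}$ with size $O(|\mathcal{S}|\cdot\sigma)$ and depth $O(\mathrm{depth}(\mathcal{S})\cdot\log\sigma)$.
   Context: An SLP for $S$ is a context-free grammar generating exactly $S$ in which each rule's right-hand side is either two nonterminals or a single terminal; $|\mathcal{S}|$ is the number of rules and $\mathrm{depth}(\mathcal{S})$ is the depth of its parse tree. The Cartesian tree of an empty string is empty; otherwise, with $i$ the index of the leftmost occurrence of the minimum of $S$, it is a root whose left subtree is the Cartesian tree of $S[1,i-1]$ and whose right subtree is the Cartesian tree of $S[i+1,n]$ (an unlabeled rooted ordered binary tree). For a rooted ordered binary tree $T$, a cluster is a connected edge-subgraph of $T$ with a top boundary node (its root) and at most one bottom boundary node (a leaf of the cluster), these being the only nodes of the cluster that may have neighbours outside it. A top-tree of $T$ is a rooted ordered binary tree whose leaves are the single-edge clusters of $T$ (labeled $e_\ell$ or $e_r$ according to whether the lower endpoint is a left or right child), whose root is the cluster consisting of all of $T$, and each of whose internal nodes is the cluster obtained by merging the edge-disjoint clusters of its two children, horizontally (sharing their top boundary node) or vertically (top boundary node of the left child cluster equals bottom boundary node of the right child cluster), the union again being a cluster; internal nodes are labeled $h$ or $v$ accordingly. A top-tree compression is the DAG of a top-tree in which identical labeled subtrees are represented once; its size is the number of DAG nodes and its depth is the height of the top-tree. -}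

module Defs where

open import Data.Nat using (ℕ; zero; suc; _+_; _*_; _≤_; _<_; _⊔_)
open import Data.Nat.Logarithm using (⌈log₂_⌉)
open import Data.Fin using (Fin; toℕ; fromℕ)
open import Data.List using (List; []; _∷_; _++_; _∷ʳ_; map; length; deduplicate)
open import Data.List.Membership.Propositional using (_∈_)
open import Data.List.Relation.Unary.All using (All)
open import Data.Vec using (Vec; lookup) renaming ([] to []ᵥ; _∷ʳ_ to _∷ʳᵥ_)
open import Data.Maybe using (Maybe; just; nothing)
open import Data.Product using (Σ; ∃; ∃-syntax; _×_; _,_)
open import Data.Sum using (_⊎_)
open import Data.Empty using (⊥)
open import Relation.Nullary using (¬_; yes; no)
open import Relation.Binary.PropositionalEquality using (_≡_; _≢_; refl; cong; cong₂)
open import Relation.Binary.Definitions using (DecidableEquality)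

-- Right-hand side of a rule of an SLP whose earlier nonterminals are Fin m:
-- a single terminal, or two (earlier) nonterminals.
data Rule (σ m : ℕ) : Set where
  term : Fin σ → Rule σ m
  pair : Fin m → Fin m → Rule σ m

-- An SLP with m rules (= m nonterminals X₀,…,X_{m-1}); X_i's right-hand side
-- only mentions X_j with j < i (straight-line order).  The start symbol is
-- the last nonterminal.
data SLP (σ : ℕ) : ℕ → Set where
  []  : SLP σ 0
  _▹_ : ∀ {m} → SLP σ m → Rule σ m → SLP σ (suc m)

expansions : ∀ {σ m} → SLP σ m → Vec (List (Fin σ)) m
expansions []                = []ᵥ
expansions (G ▹ term a)      = expansions G ∷ʳᵥ (a ∷ [])
expansions (G ▹ pair j k)    =
  expansions G ∷ʳᵥ (lookup (expansions G) j ++ lookup (expansions G) k)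

-- depth (height in edges) of the parse tree rooted at each nonterminal;
-- a rule X → a gives a parse tree of depth 1.
depths : ∀ {σ m} → SLP σ m → Vec ℕ m
depths []             = []ᵥ
depths (G ▹ term a)   = depths G ∷ʳᵥ 1
depths (G ▹ pair j k) = depths G ∷ʳᵥ suc (lookup (depths G) j ⊔ lookup (depths G) k)

generated : ∀ {σ m} → SLP σ (suc m) → List (Fin σ)
generated {m = m} G = lookup (expansions G) (fromℕ m)

slpDepth : ∀ {σ m} → SLP σ (suc m) → ℕ
slpDepth {m = m} G = lookup (depths G) (fromℕ m)

slpSize : ∀ {σ m} → SLP σ m → ℕ
slpSize {m = m} _ = m

data BT : Set where
  empty : BT
  node  : BT → BT → BT

-- IsCartesian S C : C is the Cartesian tree of S (leftmost minimum is root).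
data IsCartesian : List ℕ → BT → Set where
  cart-[] : IsCartesian [] empty
  cart-∷  : ∀ {l r : List ℕ} {x : ℕ} {tl tr : BT} →
            All (λ y → x < y) l →
            All (λ y → x ≤ y) r →
            IsCartesian l tl → IsCartesian r tr →
            IsCartesian (l ++ x ∷ r) (node tl tr)

data Dir : Set where
  L R : Dir

-- a node is addressed by its path from the root
Pos : Set
Pos = List Dir

data InT : BT → Pos → Set where
  here : ∀ {l r} → InT (node l r) []
  inL  : ∀ {l r p} → InT l p → InT (node l r) (L ∷ p)
  inR  : ∀ {l r p} → InT r p → InT (node l r) (R ∷ p)

-- an edge is given by its upper endpoint p and the direction d of its lower
-- endpoint p ∷ʳ d (a left or right child)
Edge : Set
Edge = Pos × Dir

upper : Edge → Pos
upper (p , d) = p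

lower : Edge → Pos
lower (p , d) = p ∷ʳ d

IsEdge : BT → Edge → Set
IsEdge T e = InT T (lower e)

NodeOf : List Edge → Pos → Set
NodeOf E u = ∃[ e ] (e ∈ E × (u ≡ upper e ⊎ u ≡ lower e))

data Reach (E : List Edge) : Pos → Pos → Set where
  stay : ∀ {u} → Reach E u u
  down : ∀ {p d v} → (p , d) ∈ E → Reach E (p ∷ʳ d) v → Reach E p v
  up   : ∀ {p d v} → (p , d) ∈ E → Reach E p v → Reach E (p ∷ʳ d) v

Connected : List Edge → Set
Connected E = ∀ u v → NodeOf E u → NodeOf E v → Reach E u v

Ancestor : Pos → Pos → Set
Ancestor u w = ∃[ s ] (u ++ s ≡ w)

IsRootOf : List Edge → Pos → Set
IsRootOf E t = NodeOf E t × (∀ u → NodeOf E u → Ancestor t u)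

IsLeafOf : List Edge → Pos → Set
IsLeafOf E b = ∀ d → ¬ ((b , d) ∈ E)

AdjT : BT → Pos → Pos → Set
AdjT T w x = (∃[ d ] (x ≡ w ∷ʳ d × InT T x)) ⊎ (∃[ d ] (w ≡ x ∷ʳ d))

OutsideNbr : BT → List Edge → Pos → Set
OutsideNbr T E w = ∃[ x ] (AdjT T w x × ¬ NodeOf E x)

BottomSpec : BT → List Edge → Pos → Maybe Pos → Set
BottomSpec T E t nothing  =
  ∀ w → NodeOf E w → OutsideNbr T E w → w ≡ t
BottomSpec T E t (just b) =
  NodeOf E b × b ≢ t × IsLeafOf E b × OutsideNbr T E b ×
  (∀ w → NodeOf E w → OutsideNbr T E w → w ≡ t ⊎ w ≡ b)

-- Cluster T E t b : the edge set E is a cluster of T with top boundary node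
-- t (its root) and bottom boundary node b (nothing = no bottom boundary).
record Cluster (T : BT) (E : List Edge) (t : Pos) (b : Maybe Pos) : Set where
  field
    nonempty  : E ≢ []
    edgesInT  : All (IsEdge T) E
    connected : Connected E
    root      : IsRootOf E t
    bottom    : BottomSpec T E t b

data TopTree : Set where
  eℓ er : TopTree
  h v   : TopTree → TopTree → TopTree

data ATop : Set where
  leafA : Edge → ATop
  hA vA : ATop → ATop → ATop

labelOf : Dir → TopTree
labelOf L = eℓ
labelOf R = er

erase : ATop → TopTree
erase (leafA (p , d)) = labelOf d
erase (hA a b)        = h (erase a) (erase b)
erase (vA a b)        = v (erase a) (erase b)

edgesOf : ATop → List Edge
edgesOf (leafA e) = e ∷ []
edgesOf (hA a b)  = edgesOf a ++ edgesOf b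
edgesOf (vA a b)  = edgesOf a ++ edgesOf b

Disjoint : List Edge → List Edge → Set
Disjoint E F = ∀ e → e ∈ E → e ∈ F → ⊥

data ValidTop (T : BT) : ATop → Pos → Maybe Pos → Set where
  vleaf : ∀ {e t b} → Cluster T (e ∷ []) t b → ValidTop T (leafA e) t b
  vh    : ∀ {a₁ a₂ t b₁ b₂ t' b'} →
          ValidTop T a₁ t b₁ → ValidTop T a₂ t b₂ →
          Disjoint (edgesOf a₁) (edgesOf a₂) →
          Cluster T (edgesOf a₁ ++ edgesOf a₂) t' b' →
          ValidTop T (hA a₁ a₂) t' b'
  vv    : ∀ {a₁ a₂ t₁ b₁ t₂ t' b'} →
          ValidTop T a₁ t₁ b₁ → ValidTop T a₂ t₂ (just t₁) →
          Disjoint (edgesOf a₁) (edgesOf a₂) →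
          Cluster T (edgesOf a₁ ++ edgesOf a₂) t' b' →
          ValidTop T (vA a₁ a₂) t' b'

-- IsTopTreeOf T τ : τ is a top-tree of T.  Convention: a tree without edges
-- has the empty top-tree (nothing).
IsTopTreeOf : BT → Maybe TopTree → Set
IsTopTreeOf T nothing   = ∀ e → ¬ IsEdge T e
IsTopTreeOf T (just τ)  =
  ∃[ a ] (erase a ≡ τ × (∃[ t ] ∃[ b ] ValidTop T a t b) ×
          (∀ e → (IsEdge T e → e ∈ edgesOf a) × (e ∈ edgesOf a → IsEdge T e)))

-- size of the top-tree compression (number of distinct labeled subtrees = DAG nodes)
_≟T_ : DecidableEquality TopTree
eℓ ≟T eℓ = yes refl
eℓ ≟T er = no (λ ())
eℓ ≟T h _ _ = no (λ ())
eℓ ≟T v _ _ = no (λ ())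
er ≟T eℓ = no (λ ())
er ≟T er = yes refl
er ≟T h _ _ = no (λ ())
er ≟T v _ _ = no (λ ())
h _ _ ≟T eℓ = no (λ ())
h _ _ ≟T er = no (λ ())
h _ _ ≟T v _ _ = no (λ ())
v _ _ ≟T eℓ = no (λ ())
v _ _ ≟T er = no (λ ())
v _ _ ≟T h _ _ = no (λ ())
h a b ≟T h c d with a ≟T c | b ≟T d
... | yes refl | yes refl = yes refl
... | no ¬p | _ = no (λ { refl → ¬p refl })
... | yes _ | no ¬q = no (λ { refl → ¬q refl })
v a b ≟T v c d with a ≟T c | b ≟T d
... | yes refl | yes refl = yes refl
... | no ¬p | _ = no (λ { refl → ¬p refl })
... | yes _ | no ¬q = no (λ { refl → ¬q refl })

subtrees : TopTree → List TopTree
subtrees eℓ      = eℓ ∷ []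
subtrees er      = er ∷ []
subtrees (h a b) = h a b ∷ subtrees a ++ subtrees b
subtrees (v a b) = v a b ∷ subtrees a ++ subtrees b

dagSize : Maybe TopTree → ℕ
dagSize nothing  = 0
dagSize (just τ) = length (deduplicate _≟T_ (subtrees τ))

height : TopTree → ℕ
height eℓ      = 0
height er      = 0
height (h a b) = suc (height a ⊔ height b)
height (v a b) = suc (height a ⊔ height b)

topDepth : Maybe TopTree → ℕ
topDepth nothing  = 0
topDepth (just τ) = height τ

-- log σ, clamped below by 1 (so that the bound is meaningful for σ ≤ 2)
lg : ℕ → ℕ
lg σ = ⌈log₂ σ ⌉ ⊔ 1

{-# OPTIONS --safe #-}
module Submission where

-- Split a string at the leftmost occurrence of its minimum: the left spine of the Cartesian
-- tree visits strictly increasing values, the right spine weakly increasing ones.  Grouping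
-- the right spine by value, a string is described by at most one cluster per value and
-- spine, each of them a one-hole context whose hole carries the deeper part of the spine.
-- Concatenating two strings zips the right spine of the first with the left spine of the
-- second, restricted to the values not below either minimum.  The resulting zigzag path of
-- at most 2σ clusters is merged pairwise in O(log σ) rounds and closed to a subtree, which
-- becomes part of a single new cluster; all others are reused.  So every rule of the
-- grammar costs O(σ) new top-tree nodes and O(log σ) additional depth.

open import Defs
open import Data.Empty using (⊥; ⊥-elim)
open import Data.Fin using (Fin; toℕ; fromℕ) renaming (zero to fzero; suc to fsuc)
open import Data.Fin.Properties using (toℕ<n)
open import Data.List using (List; []; _∷_; _++_; _∷ʳ_; [_]; map; length; deduplicate)
open import Data.List.Membership.Propositional using (_∈_)
open import Data.List.Membership.Propositional.Properties using (∈-++⁺ˡ; ∈-++⁺ʳ; ∈-++⁻; ∈-∃++; ∈-deduplicate⁻)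
open import Data.List.Properties using (++-assoc; ++-identityʳ; ++-cancelˡ; ++-monoid; map-++; length-++; ∷-injective; ∷ʳ-injectiveˡ)
open import Data.List.Relation.Binary.Subset.Propositional using (_⊆_)
open import Data.List.Relation.Unary.All as All using (All; []; _∷_)
open import Data.List.Relation.Unary.All.Properties using (++⁺; ++⁻ʳ)
open import Data.List.Relation.Unary.AllPairs using ([]; _∷_)
open import Data.List.Relation.Unary.Any using (here; there)
open import Data.List.Relation.Unary.Unique.DecPropositional.Properties _≟T_ using (deduplicate-!)
open import Data.List.Relation.Unary.Unique.Propositional using (Unique)
open import Data.Maybe using (Maybe; just; nothing)
open import Data.Maybe.Properties using (just-injective)
open import Data.Nat
open import Data.Nat.Logarithm using (⌈log₂_⌉; ⌈log₂⌈n/2⌉⌉≡⌈log₂n⌉∸1)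
open import Data.Nat.Properties
open import Data.Nat.Tactic.RingSolver using (solve-∀)
open import Data.Product using (∃-syntax; _×_; _,_; proj₁; proj₂)
open import Data.Sum using (_⊎_; inj₁; inj₂; map₂)
open import Data.Unit using (⊤; tt)
open import Data.Vec using (Vec; lookup) renaming ([] to []ᵥ; _∷_ to _∷ᵥ_; _∷ʳ_ to _∷ʳᵥ_)
open import Function using (_∘_; id)
open import Relation.Binary.PropositionalEquality using (_≡_; _≢_; refl; sym; trans; cong; cong₂; subst)
open import Relation.Nullary using (¬_)
open import Tactic.MonoidSolver using (solve)

-- Clusters

-- The direction in which the path from p to the lower end of the edge (p ++ s , d) leaves p.
firstDir : Pos → Dir → Dir
firstDir []      d = d
firstDir (x ∷ _) _ = x

firstDir-++ : ∀ s d z e → firstDir ((s ∷ʳ d) ++ z) e ≡ firstDir s d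
firstDir-++ []      d z e = refl
firstDir-++ (_ ∷ _) d z e = refl

-- An edge list E hanging below p by edges with directions in D, containing
-- everything of T below these edges except what lies below b.
record Region (T : BT) (E : List Edge) (p : Pos) (D : Dir → Set) (b : Maybe Pos) : Set where
  field
    start    : ∃[ d ] (p , d) ∈ E
    inside   : All (IsEdge T) E
    above    : ∀ {u d} → (u , d) ∈ E → ∃[ s ] (u ≡ p ++ s × D (firstDir s d))
    reach    : ∀ {u d} → (u , d) ∈ E → Reach E p u × Reach E u p
    upward   : ∀ {u d} → (u , d) ∈ E → u ≡ p ⊎ ∃[ u' ] ∃[ d' ] ((u' , d') ∈ E × u ≡ u' ∷ʳ d')
    full     : ∀ {d} → D d → IsEdge T (p , d) → (p , d) ∈ E
    downward : ∀ {u d} → (u , d) ∈ E →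
               b ≡ just (u ∷ʳ d) ⊎ (∀ d' → IsEdge T (u ∷ʳ d , d') → (u ∷ʳ d , d') ∈ E)
    stop     : ∀ {q} → b ≡ just q →
               (∃[ u ] ∃[ d ] ((u , d) ∈ E × q ≡ u ∷ʳ d)) ×
               (∃[ d ] IsEdge T (q , d)) ×
               (∀ {u d} → (u , d) ∈ E → ¬ Ancestor q u)

Reach-trans : ∀ {E u v w} → Reach E u v → Reach E v w → Reach E u w
Reach-trans stay       s = s
Reach-trans (down e r) s = down e (Reach-trans r s)
Reach-trans (up e r)   s = up e (Reach-trans r s)

Reach-mono : ∀ {E F u v} → (∀ {e} → e ∈ E → e ∈ F) → Reach E u v → Reach F u v
Reach-mono f stay       = stay
Reach-mono f (down e r) = down (f e) (Reach-mono f r)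
Reach-mono f (up e r)   = up (f e) (Reach-mono f r)

Ancestor-refl : ∀ p → Ancestor p p
Ancestor-refl p = [] , ++-identityʳ p

Ancestor-trans : ∀ {p q r} → Ancestor p q → Ancestor q r → Ancestor p r
Ancestor-trans {p} (s , refl) (t , refl) = s ++ t , sym (++-assoc p s t)

Ancestor-parent : ∀ p d → Ancestor p (p ∷ʳ d)
Ancestor-parent p d = d ∷ [] , refl

¬child-ancestor : ∀ (p : Pos) {d s} → (p ∷ʳ d) ++ s ≢ p
¬child-ancestor (_ ∷ p) eq = ¬child-ancestor p (proj₂ (∷-injective eq))

++-∷ʳ : (p s : Pos) (d : Dir) → (p ++ s) ∷ʳ d ≡ p ++ (s ∷ʳ d)
++-∷ʳ p s d = ++-assoc p s (d ∷ [])

module _ {T E p D b} (r : Region T E p D b) where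
  open Region r

  ancestor-upper : ∀ {u d} → (u , d) ∈ E → Ancestor p u
  ancestor-upper e∈ = proj₁ (above e∈) , sym (proj₁ (proj₂ (above e∈)))

  ancestor-node : ∀ {u} → NodeOf E u → Ancestor p u
  ancestor-node (_ , e∈ , inj₁ refl) = ancestor-upper e∈
  ancestor-node (_ , e∈ , inj₂ refl) = Ancestor-trans (ancestor-upper e∈) (Ancestor-parent _ _)

  ancestor-bottom : ∀ {q} → b ≡ just q → Ancestor p q
  ancestor-bottom eq with stop eq
  ... | (u , d , e∈ , refl) , _ = ancestor-node ((u , d) , e∈ , inj₂ refl)

  reach-node : ∀ {u} → NodeOf E u → Reach E p u × Reach E u p
  reach-node (_ , e∈ , inj₁ refl) = reach e∈
  reach-node (_ , e∈ , inj₂ refl) =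
    Reach-trans (proj₁ (reach e∈)) (down e∈ stay) , up e∈ (proj₂ (reach e∈))

  top-node : NodeOf E p
  top-node = _ , proj₂ start , inj₁ refl

  node-cases : ∀ {w} → NodeOf E w → w ≡ p ⊎ ∃[ u ] ∃[ d ] ((u , d) ∈ E × w ≡ u ∷ʳ d)
  node-cases (_ , e∈ , inj₁ refl) = upward e∈
  node-cases (_ , e∈ , inj₂ refl) = inj₂ (_ , _ , e∈ , refl)

  -- A node other than `p` is the lower end of an edge of `E`. Its parent is therefore inside, and
  -- by `downward` its children are too unless it is the bottom boundary.
  boundary : ∀ {w} → NodeOf E w → OutsideNbr T E w → w ≡ p ⊎ b ≡ just w
  boundary n (x , adj , out) with node-cases n
  ... | inj₁ eq = inj₁ eq
  boundary n (x , inj₁ (d' , refl , inT) , out) | inj₂ (u , d , e∈ , refl) with downward e∈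
  ... | inj₁ eq = inj₂ eq
  ... | inj₂ f  = ⊥-elim (out (_ , f d' inT , inj₂ refl))
  boundary n (x , inj₂ (d' , eq) , out) | inj₂ (u , d , e∈ , refl) =
    ⊥-elim (out (_ , e∈ , inj₁ (sym (∷ʳ-injectiveˡ u x eq))))

  bottomSpec : ∀ c → b ≡ c → BottomSpec T E p c
  bottomSpec nothing refl w n o with boundary n o
  ... | inj₁ eq = eq
  bottomSpec (just q) eq with stop eq
  ... | (u , d , e∈ , q≡) , (d' , inT) , below =
    (_ , e∈ , inj₂ q≡) ,
    (λ q≡p → below (proj₂ start) (subst (λ x → Ancestor x p) (sym q≡p) (Ancestor-refl p))) ,
    (λ d'' q∈ → below q∈ (Ancestor-refl q)) ,
    (q ∷ʳ d' , inj₁ (d' , refl , inT) , outside) ,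
    λ w n o → map₂ (λ e → just-injective (trans (sym e) eq)) (boundary n o)
    where
    outside : ¬ NodeOf E (q ∷ʳ d')
    outside (_ , f∈ , inj₁ refl) = below f∈ (Ancestor-parent q d')
    outside ((x , _) , f∈ , inj₂ eq') with ∷ʳ-injectiveˡ q x eq'
    ... | refl = below f∈ (Ancestor-refl q)

  region⇒cluster : Cluster T E p b
  region⇒cluster = record
    { nonempty  = λ { refl → ⊥-elim (nil (proj₂ start)) }
    ; edgesInT  = inside
    ; connected = λ u v n m → Reach-trans (proj₂ (reach-node n)) (proj₁ (reach-node m))
    ; root      = top-node , λ u → ancestor-node
    ; bottom    = bottomSpec b refl
    }
    where
    nil : ∀ {e : Edge} → e ∈ [] → ⊥
    nil ()

only : Dir → Dir → Set
only d d' = d' ≡ d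

anyDir : Dir → Set
anyDir _ = ⊤

-- `D` tells which edges at `p` must be present. A cluster with `anyDir` may hang below another in a
-- vertical merge; one with `only d` covers one child side and leaves the other to a horizontal
-- merge.
Top : BT → ATop → Pos → (Dir → Set) → Maybe Pos → Set
Top T a p D b = ValidTop T a p b × Region T (edgesOf a) p D b

module _ {T E₁ E₂ q p D b} (r₁ : Region T E₁ q anyDir b) (r₂ : Region T E₂ p D (just q)) where
  private
    module A = Region r₁
    module B = Region r₂
    foot = proj₁ (B.stop refl)
    not-below : ∀ {u d} → (u , d) ∈ E₂ → ¬ Ancestor q u
    not-below = proj₂ (proj₂ (B.stop refl))

  v-disjoint : Disjoint E₁ E₂
  v-disjoint (u , d) e₁ e₂ = not-below e₂ (ancestor-upper r₁ e₁)

  v-region : Region T (E₁ ++ E₂) p D b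
  v-region = record
    { start    = proj₁ B.start , inr (proj₂ B.start)
    ; inside   = ++⁺ A.inside B.inside
    ; above    = λ e∈ → above (∈-++⁻ E₁ e∈)
    ; reach    = λ e∈ → reach (∈-++⁻ E₁ e∈)
    ; upward   = λ e∈ → upward (∈-++⁻ E₁ e∈)
    ; full     = λ x y → inr (B.full x y)
    ; downward = λ e∈ → downward (∈-++⁻ E₁ e∈)
    ; stop     = stop
    }
    where
    inl : ∀ {e} → e ∈ E₁ → e ∈ E₁ ++ E₂
    inl = ∈-++⁺ˡ
    inr : ∀ {e} → e ∈ E₂ → e ∈ E₁ ++ E₂
    inr = ∈-++⁺ʳ E₁
    above : ∀ {u d} → (u , d) ∈ E₁ ⊎ (u , d) ∈ E₂ → ∃[ s ] (u ≡ p ++ s × D (firstDir s d))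
    above (inj₂ e) = B.above e
    above (inj₁ e) with A.above e | foot
    ... | s , refl , _ | u₂ , d₂ , e₂ , refl with B.above e₂
    ... | s₂ , refl , D₂ =
      (s₂ ∷ʳ d₂) ++ s ,
      trans (cong (_++ s) (++-∷ʳ p s₂ d₂)) (++-assoc p (s₂ ∷ʳ d₂) s) ,
      subst D (sym (firstDir-++ s₂ d₂ s _)) D₂
    foot-reach : Reach (E₁ ++ E₂) p q × Reach (E₁ ++ E₂) q p
    foot-reach with foot
    ... | u₂ , d₂ , e₂ , refl =
      Reach-trans (Reach-mono inr (proj₁ (B.reach e₂))) (down (inr e₂) stay) ,
      up (inr e₂) (Reach-mono inr (proj₂ (B.reach e₂)))
    reach : ∀ {u d} → (u , d) ∈ E₁ ⊎ (u , d) ∈ E₂ → Reach (E₁ ++ E₂) p u × Reach (E₁ ++ E₂) u p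
    reach (inj₁ e) =
      Reach-trans (proj₁ foot-reach) (Reach-mono inl (proj₁ (A.reach e))) ,
      Reach-trans (Reach-mono inl (proj₂ (A.reach e))) (proj₂ foot-reach)
    reach (inj₂ e) = Reach-mono inr (proj₁ (B.reach e)) , Reach-mono inr (proj₂ (B.reach e))
    upward : ∀ {u d} → (u , d) ∈ E₁ ⊎ (u , d) ∈ E₂ →
             u ≡ p ⊎ ∃[ u' ] ∃[ d' ] ((u' , d') ∈ E₁ ++ E₂ × u ≡ u' ∷ʳ d')
    upward (inj₂ e) = map₂ (λ { (u' , d' , f , eq) → u' , d' , inr f , eq }) (B.upward e)
    upward (inj₁ e) with A.upward e | foot
    ... | inj₁ refl | u₂ , d₂ , e₂ , eq = inj₂ (u₂ , d₂ , inr e₂ , eq)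
    ... | inj₂ (u' , d' , f , eq) | _   = inj₂ (u' , d' , inl f , eq)
    downward : ∀ {u d} → (u , d) ∈ E₁ ⊎ (u , d) ∈ E₂ →
               b ≡ just (u ∷ʳ d) ⊎ (∀ d' → IsEdge T (u ∷ʳ d , d') → (u ∷ʳ d , d') ∈ E₁ ++ E₂)
    downward (inj₁ e) = map₂ (λ f d' x → inl (f d' x)) (A.downward e)
    downward (inj₂ e) with B.downward e
    -- `q` stops being a boundary node: the lower region is full at its top, so every child edge of
    -- `q` lies in `E₁`.
    ... | inj₁ refl = inj₂ (λ d' x → inl (A.full tt x))
    ... | inj₂ f    = inj₂ (λ d' x → inr (f d' x))
    stop : ∀ {q'} → b ≡ just q' →
           (∃[ u ] ∃[ d ] ((u , d) ∈ E₁ ++ E₂ × q' ≡ u ∷ʳ d)) × (∃[ d ] IsEdge T (q' , d)) ×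
           (∀ {u d} → (u , d) ∈ E₁ ++ E₂ → ¬ Ancestor q' u)
    stop {q'} eq with A.stop eq
    ... | (u₁ , d₁ , e₁ , eq₁) , ed , below = (u₁ , d₁ , inl e₁ , eq₁) , ed , λ e → below' (∈-++⁻ E₁ e)
      where
      below' : ∀ {u d} → (u , d) ∈ E₁ ⊎ (u , d) ∈ E₂ → ¬ Ancestor q' u
      below' (inj₁ e) = below e
      below' (inj₂ e) x = not-below e (Ancestor-trans (ancestor-bottom r₁ eq) x)

vertical : ∀ {T a₁ a₂ q p D b} → Top T a₁ q anyDir b → Top T a₂ p D (just q) → Top T (vA a₁ a₂) p D b
vertical (v₁ , r₁) (v₂ , r₂) =
  vv v₁ v₂ (v-disjoint r₁ r₂) (region⇒cluster (v-region r₁ r₂)) , v-region r₁ r₂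

opposite : Dir → Dir
opposite L = R
opposite R = L

opposite-≢ : ∀ d → opposite d ≢ d
opposite-≢ L ()
opposite-≢ R ()

dir-cases : ∀ d d' → d' ≡ opposite d ⊎ d' ≡ d
dir-cases L L = inj₂ refl
dir-cases L R = inj₁ refl
dir-cases R L = inj₁ refl
dir-cases R R = inj₂ refl

module _ {T E₁ E₂ p d b} (r₁ : Region T E₁ p (only (opposite d)) nothing) (r₂ : Region T E₂ p (only d) b) where
  private
    module A = Region r₁
    module B = Region r₂

  h-disjoint : Disjoint E₁ E₂
  h-disjoint (u , c) e₁ e₂ with A.above e₁ | B.above e₂
  ... | s , refl , D₁ | s' , eq , D₂ with ++-cancelˡ p s s' eq
  ... | refl = opposite-≢ d (trans (sym D₁) D₂)

  h-region : Region T (E₁ ++ E₂) p anyDir b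
  h-region = record
    { start    = proj₁ B.start , inr (proj₂ B.start)
    ; inside   = ++⁺ A.inside B.inside
    ; above    = λ e∈ → above (∈-++⁻ E₁ e∈)
    ; reach    = λ e∈ → reach (∈-++⁻ E₁ e∈)
    ; upward   = λ e∈ → upward (∈-++⁻ E₁ e∈)
    ; full     = full
    ; downward = λ e∈ → downward (∈-++⁻ E₁ e∈)
    ; stop     = stop
    }
    where
    inl : ∀ {e} → e ∈ E₁ → e ∈ E₁ ++ E₂
    inl = ∈-++⁺ˡ
    inr : ∀ {e} → e ∈ E₂ → e ∈ E₁ ++ E₂
    inr = ∈-++⁺ʳ E₁
    above : ∀ {u c} → (u , c) ∈ E₁ ⊎ (u , c) ∈ E₂ → ∃[ s ] (u ≡ p ++ s × ⊤)
    above (inj₁ e) = proj₁ (A.above e) , proj₁ (proj₂ (A.above e)) , tt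
    above (inj₂ e) = proj₁ (B.above e) , proj₁ (proj₂ (B.above e)) , tt
    reach : ∀ {u c} → (u , c) ∈ E₁ ⊎ (u , c) ∈ E₂ → Reach (E₁ ++ E₂) p u × Reach (E₁ ++ E₂) u p
    reach (inj₁ e) = Reach-mono inl (proj₁ (A.reach e)) , Reach-mono inl (proj₂ (A.reach e))
    reach (inj₂ e) = Reach-mono inr (proj₁ (B.reach e)) , Reach-mono inr (proj₂ (B.reach e))
    upward : ∀ {u c} → (u , c) ∈ E₁ ⊎ (u , c) ∈ E₂ →
             u ≡ p ⊎ ∃[ u' ] ∃[ d' ] ((u' , d') ∈ E₁ ++ E₂ × u ≡ u' ∷ʳ d')
    upward (inj₁ e) = map₂ (λ { (u' , d' , f , eq) → u' , d' , inl f , eq }) (A.upward e)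
    upward (inj₂ e) = map₂ (λ { (u' , d' , f , eq) → u' , d' , inr f , eq }) (B.upward e)
    full : ∀ {c} → ⊤ → IsEdge T (p , c) → (p , c) ∈ E₁ ++ E₂
    full {c} _ x with dir-cases d c
    ... | inj₁ eq = inl (A.full eq x)
    ... | inj₂ eq = inr (B.full eq x)
    downward : ∀ {u c} → (u , c) ∈ E₁ ⊎ (u , c) ∈ E₂ →
               b ≡ just (u ∷ʳ c) ⊎ (∀ d' → IsEdge T (u ∷ʳ c , d') → (u ∷ʳ c , d') ∈ E₁ ++ E₂)
    downward (inj₁ e) with A.downward e
    ... | inj₂ f = inj₂ (λ d' x → inl (f d' x))
    downward (inj₂ e) = map₂ (λ f d' x → inr (f d' x)) (B.downward e)
    stop : ∀ {q} → b ≡ just q →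
           (∃[ u ] ∃[ c ] ((u , c) ∈ E₁ ++ E₂ × q ≡ u ∷ʳ c)) × (∃[ c ] IsEdge T (q , c)) ×
           (∀ {u c} → (u , c) ∈ E₁ ++ E₂ → ¬ Ancestor q u)
    stop {q} eq with B.stop eq
    ... | (u₂ , d₂ , e₂ , q≡) , ed , below = (u₂ , d₂ , inr e₂ , q≡) , ed , λ e → below' (∈-++⁻ E₁ e)
      where
      below' : ∀ {u c} → (u , c) ∈ E₁ ⊎ (u , c) ∈ E₂ → ¬ Ancestor q u
      below' (inj₂ e) x = below e x
      -- The path to `q` leaves `p` in direction `d`, so every edge below `q` does as well, whereas
      -- the edges of `E₁` leave in the opposite direction.
      below' {_} {c} (inj₁ e) (z , qz) with A.above e | B.above e₂
      ... | s , refl , D₁ | s₂ , refl , D₂ =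
        opposite-≢ d (trans (sym D₁) (trans (cong (λ w → firstDir w c) s≡) (trans (firstDir-++ s₂ d₂ z c) D₂)))
        where
        s≡ : s ≡ (s₂ ∷ʳ d₂) ++ z
        s≡ = ++-cancelˡ p _ _ (trans (sym qz) (trans (cong (_++ z) (trans q≡ (++-∷ʳ p s₂ d₂))) (++-assoc p _ z)))

horizontal : ∀ {T a₁ a₂ p d b} → Top T a₁ p (only (opposite d)) nothing → Top T a₂ p (only d) b →
             Top T (hA a₁ a₂) p anyDir b
horizontal (v₁ , r₁) (v₂ , r₂) =
  vh v₁ v₂ (h-disjoint r₁ r₂) (region⇒cluster (h-region r₁ r₂)) , h-region r₁ r₂

-- With the sibling missing there is nothing to merge horizontally: the half cluster is already full
-- at `p`.
lone-child : ∀ {T a p d b} → ¬ IsEdge T (p , opposite d) → Top T a p (only d) b → Top T a p anyDir b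
lone-child {T} {a} {p} {d} ¬e (v₁ , r) = v₁ , record
  { start = start ; inside = inside ; reach = reach ; upward = upward ; downward = downward ; stop = stop
  ; above = λ e → proj₁ (above e) , proj₁ (proj₂ (above e)) , tt
  ; full  = λ {c} _ x → f c x (dir-cases d c)
  }
  where
  open Region r
  f : ∀ c → IsEdge T (p , c) → c ≡ opposite d ⊎ c ≡ d → (p , c) ∈ edgesOf a
  f c x (inj₁ refl) = ⊥-elim (¬e x)
  f c x (inj₂ eq)   = full eq x

InT-prefix : ∀ {T} p {s} → InT T (p ++ s) → InT T p
InT-prefix []      {[]}    i       = i
InT-prefix []      {_ ∷ _} (inL i) = here
InT-prefix []      {_ ∷ _} (inR i) = here
InT-prefix (L ∷ p) (inL i) = inL (InT-prefix p i)
InT-prefix (R ∷ p) (inR i) = inR (InT-prefix p i)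

-- Without a bottom boundary, `downward` puts all child edges of a cluster edge into the cluster;
-- `go` follows this along the path to the given edge.
covers : ∀ {T a} → Top T a [] anyDir nothing → ∀ e → IsEdge T e → e ∈ edgesOf a
covers {T} {a} (_ , r) = λ { ([] , d) x → full tt x ; (c ∷ s , d) x → go [] s (full tt (InT-prefix (c ∷ []) x)) x }
  where
  open Region r
  go : ∀ u {c} s {d} → (u , c) ∈ edgesOf a → IsEdge T ((u ∷ʳ c) ++ s , d) → ((u ∷ʳ c) ++ s , d) ∈ edgesOf a
  go u {c} s {d} e x with downward e
  go u {c} [] {d} e x | inj₂ f rewrite ++-identityʳ (u ∷ʳ c) = f d x
  go u {c} (c' ∷ s) {d} e x | inj₂ f =
    subst (λ z → (z , d) ∈ edgesOf a) eq
      (go (u ∷ʳ c) s (f c' (InT-prefix ((u ∷ʳ c) ∷ʳ c') (subst (InT T) (++-∷ʳ _ s d) x'))) x')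
    where
    eq : ((u ∷ʳ c) ∷ʳ c') ++ s ≡ (u ∷ʳ c) ++ c' ∷ s
    eq = ++-assoc (u ∷ʳ c) (c' ∷ []) s
    x' : IsEdge T (((u ∷ʳ c) ∷ʳ c') ++ s , d)
    x' = subst (λ z → IsEdge T (z , d)) (sym eq) x

-- Subtrees at positions and single-edge clusters

data NonEmpty : BT → Set where
  node : ∀ {l r} → NonEmpty (node l r)

data HasEdge : BT → Set where
  left  : ∀ {l r} → NonEmpty l → HasEdge (node l r)
  right : ∀ {l r} → NonEmpty r → HasEdge (node l r)

HasEdge⇒NonEmpty : ∀ {t} → HasEdge t → NonEmpty t
HasEdge⇒NonEmpty (left _)  = node
HasEdge⇒NonEmpty (right _) = node

data At : BT → Pos → BT → Set where
  here : ∀ {t} → At t [] t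
  inL  : ∀ {l r p t} → At l p t → At (node l r) (L ∷ p) t
  inR  : ∀ {l r p t} → At r p t → At (node l r) (R ∷ p) t

child : Dir → BT → BT
child d empty      = empty
child L (node l _) = l
child R (node _ r) = r

At-child : ∀ {T p t} d → At T p t → NonEmpty (child d t) → At T (p ∷ʳ d) (child d t)
At-child {t = node l r} L here n = inL here
At-child {t = node l r} R here n = inR here
At-child d (inL a) n = inL (At-child d a n)
At-child d (inR a) n = inR (At-child d a n)

At⇒InT : ∀ {T p t s} → At T p t → InT t s → InT T (p ++ s)
At⇒InT here    i = i
At⇒InT (inL a) i = inL (At⇒InT a i)
At⇒InT (inR a) i = inR (At⇒InT a i)

InT⇒At : ∀ {T p t s} → At T p t → InT T (p ++ s) → InT t s
InT⇒At here    i       = i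
InT⇒At (inL a) (inL i) = InT⇒At a i
InT⇒At (inR a) (inR i) = InT⇒At a i

child-InT : ∀ {t} d → NonEmpty (child d t) → InT t (d ∷ [])
child-InT {node (node _ _) _} L n = inL here
child-InT {node _ (node _ _)} R n = inR here

InT-child : ∀ {t} d → InT t (d ∷ []) → NonEmpty (child d t)
InT-child L (inL here) = node
InT-child R (inR here) = node

-- The bottom boundary of a cluster whose lowest node q carries the subtree t.
bottomOf : BT → Pos → Maybe Pos
bottomOf empty                  q = nothing
bottomOf (node empty empty)     q = nothing
bottomOf (node (node _ _) _)    q = just q
bottomOf (node empty (node _ _)) q = just q

bottomOf-just : ∀ {t q} → HasEdge t → bottomOf t q ≡ just q
bottomOf-just {node (node _ _) _} (left _)          = refl
bottomOf-just {node (node _ _) _} (right _)         = refl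
bottomOf-just {node empty (node _ _)} (right _)     = refl

bottomOf-cases : ∀ t q → (bottomOf t q ≡ nothing × (∀ d → ¬ NonEmpty (child d t))) ⊎
                         (bottomOf t q ≡ just q × ∃[ d ] NonEmpty (child d t))
bottomOf-cases empty                  q = inj₁ (refl , λ { L () ; R () })
bottomOf-cases (node empty empty)     q = inj₁ (refl , λ { L () ; R () })
bottomOf-cases (node (node _ _) _)    q = inj₂ (refl , L , node)
bottomOf-cases (node empty (node _ _)) q = inj₂ (refl , R , node)

edge-top : ∀ {T p t} d → At T p t → NonEmpty (child d t) →
           Top T (leafA (p , d)) p (only d) (bottomOf (child d t) (p ∷ʳ d))
edge-top {T} {p} {t} d at n = vleaf (region⇒cluster region) , region
  where
  q = p ∷ʳ d
  at' = At-child d at n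
  region : Region T ((p , d) ∷ []) p (only d) (bottomOf (child d t) q)
  region = record
    { start    = d , here refl
    ; inside   = At⇒InT at (child-InT d n) ∷ []
    ; above    = λ { (here refl) → [] , sym (++-identityʳ p) , refl }
    ; reach    = λ { (here refl) → stay , stay }
    ; upward   = λ { (here refl) → inj₁ refl }
    ; full     = λ { refl x → here refl }
    ; downward = λ { (here refl) → down-case (bottomOf-cases (child d t) q) }
    ; stop     = λ eq → stop-case eq (bottomOf-cases (child d t) q)
    }
    where
    down-case : (bottomOf (child d t) q ≡ nothing × (∀ c → ¬ NonEmpty (child c (child d t)))) ⊎
                (bottomOf (child d t) q ≡ just q × ∃[ c ] NonEmpty (child c (child d t))) →
                bottomOf (child d t) q ≡ just q ⊎ (∀ c → IsEdge T (q , c) → (q , c) ∈ (p , d) ∷ [])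
    down-case (inj₂ (eq , _)) = inj₁ eq
    down-case (inj₁ (_ , f))  = inj₂ λ c x → ⊥-elim (f c (InT-child c (InT⇒At at' x)))
    stop-case : ∀ {q'} → bottomOf (child d t) q ≡ just q' →
                (bottomOf (child d t) q ≡ nothing × (∀ c → ¬ NonEmpty (child c (child d t)))) ⊎
                (bottomOf (child d t) q ≡ just q × ∃[ c ] NonEmpty (child c (child d t))) →
                (∃[ u ] ∃[ c ] ((u , c) ∈ (p , d) ∷ [] × q' ≡ u ∷ʳ c)) × (∃[ c ] IsEdge T (q' , c)) ×
                (∀ {u c} → (u , c) ∈ (p , d) ∷ [] → ¬ Ancestor q' u)
    stop-case eq (inj₁ (eq' , _)) with trans (sym eq') eq
    ... | ()
    stop-case eq (inj₂ (eq' , c , m)) with trans (sym eq') eq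
    ... | refl = (p , d , here refl , refl) , (c , At⇒InT at' (child-InT c m)) ,
                 λ { (here refl) (s , e) → ¬child-ancestor p e }

-- Top-trees of subtrees and contexts

leaf : BT
leaf = node empty empty

graft : Dir → BT → BT → BT
graft L t o = node t o
graft R t o = node o t

child-graft : ∀ d t o → child d (graft d t o) ≡ t
child-graft L t o = refl
child-graft R t o = refl

child-graft-opposite : ∀ d t o → child (opposite d) (graft d t o) ≡ o
child-graft-opposite L t o = refl
child-graft-opposite R t o = refl

HasEdge-graft : ∀ d {t} o → NonEmpty t → HasEdge (graft d t o)
HasEdge-graft L o n = left n
HasEdge-graft R o n = right n

-- Quantifying over all host trees `T` and positions `p` is what makes sharing possible: one DAG
-- node serves every occurrence of `t`, and only the erased labels are fixed.
TreeRep : BT → TopTree → Set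
TreeRep t τ = ∀ {T p} → At T p t → ∃[ a ] (erase a ≡ τ × Top T a p anyDir nothing)

-- τ represents the one-hole context K, including the edge leading to the hole.
CtxRep : (BT → BT) → TopTree → Set
CtxRep K τ = ∀ {T p} t → At T p (K t) → NonEmpty t →
  ∃[ a ] ∃[ q ] (erase a ≡ τ × At T q t × Top T a p anyDir (bottomOf t q))

-- τ represents the subtree t together with the edge of direction d leading to it.
HalfRep : Dir → BT → TopTree → Set
HalfRep d t τ = ∀ {T p t₀} → At T p t₀ → child d t₀ ≡ t →
  ∃[ a ] (erase a ≡ τ × Top T a p (only d) nothing)

-- A single node in the hole contributes no edge of its own and has no children, so the cluster of
-- the context just loses its bottom boundary.
ctx-single : ∀ {K τ} → CtxRep K τ → TreeRep (K leaf) τ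
ctx-single r at with r leaf at node
... | a , q , eq , _ , top = a , eq , top

-- The left argument of `v` is the lower cluster, hence `v τ₂ τ₁`. `HasEdge t` makes the hole
-- position a genuine bottom boundary of the upper cluster.
ctx-tree : ∀ {K t τ₁ τ₂} → CtxRep K τ₁ → HasEdge t → TreeRep t τ₂ → TreeRep (K t) (v τ₂ τ₁)
ctx-tree {t = t} r₁ he r₂ {T} {p} at with r₁ t at (HasEdge⇒NonEmpty he)
... | a₁ , q , refl , at' , top₁ with r₂ at'
... | a₂ , refl , top₂ = vA a₂ a₁ , refl , vertical top₂ (subst (Top T a₁ p anyDir) (bottomOf-just he) top₁)

ctx-ctx : ∀ {K K' τ₁ τ₂} → (∀ {t} → NonEmpty t → HasEdge (K' t)) →
          CtxRep K τ₁ → CtxRep K' τ₂ → CtxRep (K ∘ K') (v τ₂ τ₁)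
ctx-ctx {K' = K'} he r₁ r₂ {T} {p} t at n with r₁ (K' t) at (HasEdge⇒NonEmpty (he n))
... | a₁ , q , refl , at' , top₁ with r₂ t at' n
... | a₂ , q' , refl , at'' , top₂ =
  vA a₂ a₁ , q' , refl , at'' , vertical top₂ (subst (Top T a₁ p anyDir) (bottomOf-just (he n)) top₁)

half-single : ∀ {d} → HalfRep d leaf (labelOf d)
half-single {d} {T} {p} {t₀} at eq =
  leafA (p , d) , refl ,
  subst (λ c → Top T (leafA (p , d)) p (only d) (bottomOf c (p ∷ʳ d))) eq
    (edge-top d at (subst NonEmpty (sym eq) node))

half-tree : ∀ {d t τ} → HasEdge t → TreeRep t τ → HalfRep d t (v τ (labelOf d))
half-tree {d} {t} he r {T} {p} {t₀} at eq with r (subst (At T (p ∷ʳ d)) eq (At-child d at ne))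
  where ne = subst NonEmpty (sym eq) (HasEdge⇒NonEmpty he)
... | a , refl , top =
  vA a (leafA (p , d)) , refl ,
  vertical top (subst (Top T (leafA (p , d)) p (only d))
    (trans (cong (λ c → bottomOf c (p ∷ʳ d)) eq) (bottomOf-just he))
    (edge-top d at (subst NonEmpty (sym eq) (HasEdge⇒NonEmpty he))))

no-child : ∀ {T p t} d → At T p t → child d t ≡ empty → ¬ IsEdge T (p , d)
no-child d at eq x with subst NonEmpty eq (InT-child d (InT⇒At at x))
... | ()

half-alone : ∀ {d t τ} → HalfRep d t τ → TreeRep (graft d t empty) τ
half-alone {d} {t} r at with r at (child-graft d t empty)
... | a , eq , top = a , eq , lone-child (no-child (opposite d) at (child-graft-opposite d t empty)) top

halves-tree : ∀ {d t o τ₁ τ₂} → HalfRep (opposite d) o τ₁ → HalfRep d t τ₂ → TreeRep (graft d t o) (h τ₁ τ₂)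
halves-tree {d} {t} {o} r₁ r₂ at with r₁ at (child-graft-opposite d t o) | r₂ at (child-graft d t o)
... | a₁ , refl , top₁ | a₂ , refl , top₂ = hA a₁ a₂ , refl , horizontal top₁ top₂

module _ {T p} d t o (at : At T p (graft d t o)) (n : NonEmpty t) where
  private
    n' : NonEmpty (child d (graft d t o))
    n' = subst NonEmpty (sym (child-graft d t o)) n

  graft-at : At T (p ∷ʳ d) t
  graft-at = subst (At T (p ∷ʳ d)) (child-graft d t o) (At-child d at n')

  graft-edge : Top T (leafA (p , d)) p (only d) (bottomOf t (p ∷ʳ d))
  graft-edge = subst (λ c → Top T (leafA (p , d)) p (only d) (bottomOf c (p ∷ʳ d)))
    (child-graft d t o) (edge-top d at n')

frame-alone : ∀ d → CtxRep (λ t → graft d t empty) (labelOf d)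
frame-alone d {T} {p} t at n =
  leafA (p , d) , p ∷ʳ d , refl , graft-at d t empty at n ,
  lone-child (no-child (opposite d) at (child-graft-opposite d t empty)) (graft-edge d t empty at n)

frame-half : ∀ d {o τ} → HalfRep (opposite d) o τ → CtxRep (λ t → graft d t o) (h τ (labelOf d))
frame-half d {o} r {T} {p} t at n with r at (child-graft-opposite d t o)
... | a , refl , top =
  hA a (leafA (p , d)) , p ∷ʳ d , refl , graft-at d t o at n , horizontal top (graft-edge d t o at n)

-- DAG nodes: sharing, counting and height

-- U lists the nodes of the top-tree DAG built so far; Grow n adds at most n nodes.
record Library (U : List TopTree) : Set where
  field
    labels : ∀ d → labelOf d ∈ U
    closed : ∀ {τ x} → τ ∈ U → x ∈ subtrees τ → x ∈ U

record Grow (n : ℕ) (U : List TopTree) (F : List TopTree → Set) : Set where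
  constructor grown
  field
    {U'}   : List TopTree
    lib    : Library U'
    extend : U ⊆ U'
    size   : length U' ≤ n + length U
    result : F U'

pure : ∀ {n U F} → Library U → F U → Grow n U F
pure {n} {U} lib x = grown lib id (m≤n+m (length U) n) x

_>>=_ : ∀ {m n U F G} → Grow m U F → (∀ {U'} → Library U' → U ⊆ U' → F U' → Grow n U' G) → Grow (m + n) U G
_>>=_ {m} {n} {U} (grown lib e s x) f with f lib e x
... | grown lib' e' s' y = grown lib' (λ z → e' (e z)) size' y
  where
  size' : _ ≤ m + n + length U
  size' = ≤-trans s' (≤-trans (+-monoʳ-≤ n s)
    (≤-reflexive (trans (sym (+-assoc n m _)) (cong (_+ length U) (+-comm n m)))))

mapGrow : ∀ {n U F G} → (∀ {U'} → U ⊆ U' → F U' → G U') → Grow n U F → Grow n U G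
mapGrow f (grown lib e s x) = grown lib e s (f e x)

resize : ∀ {m n U F} → m ≤ n → Grow m U F → Grow n U F
resize m≤n (grown lib e s x) = grown lib e (≤-trans s (+-monoˡ-≤ _ m≤n)) x

Good : List TopTree → ℕ → TopTree → Set
Good U B τ = τ ∈ U × height τ ≤ B

weakenGood : ∀ {U U' B B' τ} → U ⊆ U' → B ≤ B' → Good U B τ → Good U' B' τ
weakenGood e b (i , j) = e i , ≤-trans j b

good-label : ∀ {U B} → Library U → ∀ d → Good U B (labelOf d)
good-label lib L = Library.labels lib L , z≤n
good-label lib R = Library.labels lib R , z≤n

add : ∀ {U τ} → Library U → (∀ {x} → x ∈ subtrees τ → x ∈ τ ∷ U) → Library (τ ∷ U)
add lib f = record
  { labels = λ d → there (labels d)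
  ; closed = λ { (here refl) x∈ → f x∈ ; (there i) x∈ → there (closed i x∈) }
  }
  where open Library lib

add-++ : ∀ {U τ τ₁ τ₂ x} → Library U → τ₁ ∈ U → τ₂ ∈ U → x ∈ subtrees τ₁ ++ subtrees τ₂ → x ∈ τ ∷ U
add-++ {τ₁ = τ₁} lib i₁ i₂ x∈ with ∈-++⁻ (subtrees τ₁) x∈
... | inj₁ x∈₁ = there (Library.closed lib i₁ x∈₁)
... | inj₂ x∈₂ = there (Library.closed lib i₂ x∈₂)

make-v : ∀ {U B τ₁ τ₂} → Library U → Good U B τ₁ → Good U B τ₂ → Grow 1 U (λ U' → Good U' (suc B) (v τ₁ τ₂))
make-v {U} lib (i₁ , h₁) (i₂ , h₂) =
  grown (add lib λ { (here eq) → here eq ; (there x∈) → add-++ lib i₁ i₂ x∈ })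
    there ≤-refl (here refl , s≤s (⊔-lub h₁ h₂))

make-h : ∀ {U B τ₁ τ₂} → Library U → Good U B τ₁ → Good U B τ₂ → Grow 1 U (λ U' → Good U' (suc B) (h τ₁ τ₂))
make-h {U} lib (i₁ , h₁) (i₂ , h₂) =
  grown (add lib λ { (here eq) → here eq ; (there x∈) → add-++ lib i₁ i₂ x∈ })
    there ≤-refl (here refl , s≤s (⊔-lub h₁ h₂))

-- Trees with at most one node have no edges and hence no top-tree; they occupy no DAG node and form
-- cases of their own.
data Tree (U : List TopTree) (B : ℕ) : BT → Set where
  none   : Tree U B empty
  single : Tree U B leaf
  big    : ∀ {t τ} → HasEdge t → Good U B τ → TreeRep t τ → Tree U B t

weakenTree : ∀ {U U' B B' t} → U ⊆ U' → B ≤ B' → Tree U B t → Tree U' B' t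
weakenTree e b none         = none
weakenTree e b single       = single
weakenTree e b (big he g r) = big he (weakenGood e b g) r

data Half (U : List TopTree) (B : ℕ) (d : Dir) : BT → Set where
  none : Half U B d empty
  some : ∀ {t τ} → NonEmpty t → Good U B τ → HalfRep d t τ → Half U B d t

weakenHalf : ∀ {U U' B B' d t} → U ⊆ U' → B ≤ B' → Half U B d t → Half U' B' d t
weakenHalf e b none         = none
weakenHalf e b (some n g r) = some n (weakenGood e b g) r

half : ∀ {U B t} d → Library U → Tree U B t → Grow 1 U (λ U' → Half U' (suc B) d t)
half d lib none         = pure lib none
half d lib single       = pure lib (some node (good-label lib d) half-single)
half d lib (big he g r) =
  mapGrow (λ _ g' → some (HasEdge⇒NonEmpty he) g' (half-tree he r)) (make-v lib g (good-label lib d))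

joinHalves : ∀ {U B t o} d → Library U → Half U B (opposite d) o → Half U B d t →
             Grow 1 U (λ U' → Tree U' (suc B) (graft d t o))
joinHalves L lib none none = pure lib single
joinHalves R lib none none = pure lib single
joinHalves d lib none (some n g r) =
  pure lib (big (HasEdge-graft d empty n) (weakenGood id (n≤1+n _) g) (half-alone r))
joinHalves L lib (some n g r) none =
  pure lib (big (right n) (weakenGood id (n≤1+n _) g) (half-alone r))
joinHalves R lib (some n g r) none =
  pure lib (big (left n) (weakenGood id (n≤1+n _) g) (half-alone r))
joinHalves d lib (some n g r) (some n' g' r') =
  mapGrow (λ _ g'' → big (HasEdge-graft d _ n') g'' (halves-tree r r')) (make-h lib g g')

nodeTree : ∀ {U B l r} → Library U → Tree U B l → Tree U B r → Grow 3 U (λ U' → Tree U' (2 + B) (node l r))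
nodeTree lib tl tr =
  half L lib tl >>= λ lib₁ e₁ hl →
  half R lib₁ (weakenTree e₁ ≤-refl tr) >>= λ lib₂ e₂ hr →
  joinHalves R lib₂ (weakenHalf e₂ ≤-refl hl) hr

-- `ended` is stored separately because the cluster `τ` contains the edge to the hole. With an empty
-- hole that edge is absent, so `τ` does not represent `K empty`.
record Context (U : List TopTree) (B : ℕ) (K : BT → BT) : Set where
  field
    HasEdge-plug : ∀ {t} → NonEmpty t → HasEdge (K t)
    {τ}          : TopTree
    good         : Good U B τ
    rep          : CtxRep K τ
    ended        : Tree U B (K empty)

weakenContext : ∀ {U U' B B' K} → U ⊆ U' → B ≤ B' → Context U B K → Context U' B' K
weakenContext e b c = record
  { HasEdge-plug = HasEdge-plug ; good = weakenGood e b good ; rep = rep ; ended = weakenTree e b ended }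
  where open Context c

plugTree : ∀ {U B K t} → Library U → Context U B K → Tree U B t → Grow 1 U (λ U' → Tree U' (suc B) (K t))
plugTree lib c none         = pure lib (weakenTree id (n≤1+n _) (Context.ended c))
plugTree lib c single       = pure lib (big (HasEdge-plug node) (weakenGood id (n≤1+n _) good) (ctx-single rep))
  where open Context c
plugTree lib c (big he g r) =
  mapGrow (λ _ g' → big (HasEdge-plug (HasEdge⇒NonEmpty he)) g' (ctx-tree rep he r)) (make-v lib g good)
  where open Context c

-- Two nodes: one merge for the composed context, and one for its version with an empty hole.
composeContext : ∀ {U B K K'} → Library U → Context U B K → Context U B K' →
                 Grow 2 U (λ U' → Context U' (suc B) (K ∘ K'))
composeContext lib c c' =
  plugTree lib c C'.ended >>= λ lib₁ e₁ end →
  mapGrow (λ e₂ g → record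
    { HasEdge-plug = λ n → C.HasEdge-plug (HasEdge⇒NonEmpty (C'.HasEdge-plug n))
    ; good = g
    ; rep = ctx-ctx C'.HasEdge-plug C.rep C'.rep
    ; ended = weakenTree e₂ ≤-refl end
    })
    (make-v lib₁ (weakenGood e₁ ≤-refl C'.good) (weakenGood e₁ ≤-refl C.good))
  where
  module C = Context c
  module C' = Context c'

-- One spine node with off-spine subtree `o`. For nonempty `o`, its half cluster alone gives the
-- `ended` tree, and a horizontal merge with the hole edge gives the context.
frameContext : ∀ {U B o} d → Library U → Tree U B o → Grow 3 U (λ U' → Context U' (2 + B) (λ t → graft d t o))
frameContext {U} {B} {o} d lib to = half (opposite d) lib to >>= λ lib₁ e₁ ho → go lib₁ ho
  where
  go : ∀ {U' o} → Library U' → Half U' (suc B) (opposite d) o →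
       Grow 2 U' (λ U'' → Context U'' (2 + B) (λ t → graft d t o))
  go lib₁ none = resize (n≤1+n 1) (
    mapGrow (λ e end → record
      { HasEdge-plug = HasEdge-graft d empty ; good = weakenGood e ≤-refl (good-label lib₁ d)
      ; rep = frame-alone d ; ended = end })
      (joinHalves d lib₁ none none))
  go {o = o} lib₁ (some n g r) =
    joinHalves d lib₁ (some n g r) none >>= λ lib₂ e₂ end →
    mapGrow (λ e₃ g' → record
      { HasEdge-plug = HasEdge-graft d o ; good = g'
      ; rep = frame-half d r ; ended = weakenTree e₃ ≤-refl end })
      (make-h lib₂ (weakenGood e₂ ≤-refl g) (good-label lib₂ d))

-- Spine decompositions of strings

-- If the splits differed, the letter of the earlier one would lie left of the other, hence be
-- strictly larger, and the other would lie right of it, hence be at least as large.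
leftmost-minimum-unique : ∀ {x x' : ℕ} l {r} l' {r'} → l ++ x ∷ r ≡ l' ++ x' ∷ r' →
  All (x <_) l → All (x ≤_) r → All (x' <_) l' → All (x' ≤_) r' → l ≡ l' × x ≡ x' × r ≡ r'
leftmost-minimum-unique []      []       refl _ _ _ _ = refl , refl , refl
leftmost-minimum-unique []      (_ ∷ l') refl _ x≤ (x'<x ∷ _) _ =
  ⊥-elim (<⇒≱ x'<x (All.head (++⁻ʳ l' x≤)))
leftmost-minimum-unique (_ ∷ l) []       refl (x<x' ∷ _) _ _ x'≤ =
  ⊥-elim (<⇒≱ x<x' (All.head (++⁻ʳ l x'≤)))
leftmost-minimum-unique (_ ∷ l) (_ ∷ l') eq (_ ∷ a) b (_ ∷ c) d with ∷-injective eq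
... | refl , eq' with leftmost-minimum-unique l l' eq' a b c d
... | refl , rest = refl , rest

cartesian-unique : ∀ {s s' t t'} → s ≡ s' → IsCartesian s t → IsCartesian s' t' → t ≡ t'
cartesian-unique _ cart-[] cart-[] = refl
cartesian-unique eq cart-[] (cart-∷ {l = []} _ _ _ _) with eq
... | ()
cartesian-unique eq cart-[] (cart-∷ {l = _ ∷ _} _ _ _ _) with eq
... | ()
cartesian-unique eq (cart-∷ {l = []} _ _ _ _) cart-[] with eq
... | ()
cartesian-unique eq (cart-∷ {l = _ ∷ _} _ _ _ _) cart-[] with eq
... | ()
cartesian-unique eq (cart-∷ {l = l} a b cl cr) (cart-∷ {l = l'} a' b' cl' cr')
  with leftmost-minimum-unique l l' eq a b a' b'
... | l≡ , _ , r≡ = cong₂ node (cartesian-unique l≡ cl cl') (cartesian-unique r≡ cr cr')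

-- `pre` and `post` are the letters that the context puts around the hole, bounded below by `lo`;
-- letters in the hole must be at least `hi`. Items nest when the `lo` of the inner one is the `hi`
-- of the outer one.
record Item (U : List TopTree) (B lo hi : ℕ) (pre post : List ℕ) : Set where
  field
    {K}     : BT → BT
    context : Context U B K
    lo≤hi   : lo ≤ hi
    lo≤pre  : All (lo ≤_) pre
    lo≤post : All (lo ≤_) post
    cart    : ∀ {s t} → All (hi ≤_) s → IsCartesian s t → IsCartesian (pre ++ s ++ post) (K t)

weakenItem : ∀ {U U' B B' lo hi pre post} → U ⊆ U' → B ≤ B' → Item U B lo hi pre post → Item U' B' lo hi pre post
weakenItem e b i = record
  { context = weakenContext e b context ; lo≤hi = lo≤hi ; lo≤pre = lo≤pre ; lo≤post = lo≤post ; cart = cart }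
  where open Item i

All-≤-trans : ∀ {a b w} → a ≤ b → All (b ≤_) w → All (a ≤_) w
All-≤-trans a≤b = All.map (≤-trans a≤b)

lowerItem : ∀ {U B lo' lo hi pre post} → lo' ≤ lo → Item U B lo hi pre post → Item U B lo' hi pre post
lowerItem l i = record
  { context = context ; lo≤hi = ≤-trans l lo≤hi ; lo≤pre = All-≤-trans l lo≤pre
  ; lo≤post = All-≤-trans l lo≤post ; cart = cart }
  where open Item i

composeItem : ∀ {U B lo mid hi pre post pre' post'} → Library U →
  Item U B lo mid pre post → Item U B mid hi pre' post' →
  Grow 2 U (λ U' → Item U' (suc B) lo hi (pre ++ pre') (post' ++ post))
composeItem {mid = mid} {hi} {pre} {post} {pre'} {post'} lib i j = mapGrow (λ _ c → record
  { context = c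
  ; lo≤hi   = ≤-trans I.lo≤hi J.lo≤hi
  ; lo≤pre  = ++⁺ I.lo≤pre (All-≤-trans I.lo≤hi J.lo≤pre)
  ; lo≤post = ++⁺ (All-≤-trans I.lo≤hi J.lo≤post) I.lo≤post
  ; cart    = λ {s} {t} hi≤s ct → subst (λ w → IsCartesian w (I.K (J.K t))) (eq s)
                (I.cart (++⁺ J.lo≤pre (++⁺ (All-≤-trans J.lo≤hi hi≤s) J.lo≤post)) (J.cart hi≤s ct))
  }) (composeContext lib I.context J.context)
  where
  module I = Item i
  module J = Item j
  eq : ∀ s → pre ++ (pre' ++ s ++ post') ++ post ≡ (pre ++ pre') ++ s ++ post' ++ post
  eq s = solve (++-monoid ℕ)

-- The hole is the right child, where the value `a` may occur again, so `hi` equals `lo`. This is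
-- why items of equal value can be composed.
rightItem : ∀ {U B a w o} → Library U → All (a <_) w → IsCartesian w o → Tree U B o →
            Grow 3 U (λ U' → Item U' (2 + B) a a (w ++ [ a ]) [])
rightItem {a = a} {w} {o} lib a<w co to = mapGrow (λ _ c → record
  { context = c
  ; lo≤hi   = ≤-refl
  ; lo≤pre  = ++⁺ (All.map <⇒≤ a<w) (≤-refl ∷ [])
  ; lo≤post = []
  ; cart    = λ {s} {t} a≤s ct → subst (λ y → IsCartesian y (node o t)) (eq s) (cart-∷ a<w a≤s co ct)
  }) (frameContext R lib to)
  where
  eq : ∀ s → w ++ a ∷ s ≡ (w ++ [ a ]) ++ s ++ []
  eq s = trans (sym (++-assoc w [ a ] s)) (cong ((w ++ [ a ]) ++_) (sym (++-identityʳ s)))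

-- The hole is the left child of a leftmost minimum, so its letters exceed `a` strictly and `hi` is
-- `suc a`.
leftItem : ∀ {U B a w o} → Library U → All (a ≤_) w → IsCartesian w o → Tree U B o →
           Grow 3 U (λ U' → Item U' (2 + B) a (suc a) [] (a ∷ w))
leftItem lib a≤w co to = mapGrow (λ _ c → record
  { context = c ; lo≤hi = n≤1+n _ ; lo≤pre = [] ; lo≤post = ≤-refl ∷ a≤w
  ; cart = λ a<s ct → cart-∷ a<s a≤w ct co
  }) (frameContext L lib to)

-- Chains of nested items and their balanced merging

data Chain (U : List TopTree) (B lo : ℕ) : ℕ → List ℕ → List ℕ → Set where
  []   : Chain U B lo 0 [] []
  cons : ∀ {mid n pre post w z w' z'} → Item U B lo mid pre post → Chain U B mid n w z →
         w' ≡ pre ++ w → z' ≡ z ++ post → Chain U B lo (suc n) w' z'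

weakenChain : ∀ {U U' B B' lo n w z} → U ⊆ U' → B ≤ B' → Chain U B lo n w z → Chain U' B' lo n w z
weakenChain e b []               = []
weakenChain e b (cons i c eq eq') = cons (weakenItem e b i) (weakenChain e b c) eq eq'

lowerChain : ∀ {U B lo lo' n w z} → lo' ≤ lo → Chain U B lo n w z → Chain U B lo' n w z
lowerChain l []               = []
lowerChain l (cons i c eq eq') = cons (lowerItem l i) c eq eq'

pairUp : ∀ {U B lo n w z} → Library U → Chain U B lo n w z →
         Grow (2 * ⌊ n /2⌋) U (λ U' → Chain U' (suc B) lo ⌈ n /2⌉ w z)
pairUp lib []                    = pure lib []
pairUp lib (cons i [] eq eq')    = pure lib (cons (weakenItem id (n≤1+n _) i) [] eq eq')
pairUp lib
  (cons {pre = p₁} {post = q₁} i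
    (cons {n = n} {pre = p₂} {post = q₂} {w = w} {z = z} j c refl refl) eq eq') =
  resize (≤-reflexive (sym (*-suc 2 ⌊ n /2⌋)))
    (composeItem lib i j >>= λ lib₁ e₁ ij →
     mapGrow (λ e₂ c' → cons (weakenItem e₂ ≤-refl ij) c'
               (trans eq (sym (++-assoc p₁ p₂ w))) (trans eq' (++-assoc z q₂ q₁)))
       (pairUp lib₁ (weakenChain e₁ ≤-refl c)))

-- Merging neighbours in rounds keeps the depth logarithmic in the length of the chain.
chainTree : ∀ {U B lo n w z} d → Library U → n ≤ 2 ^ d → Chain U B lo n w z →
  Grow (2 * n) U (λ U' → All (lo ≤_) (w ++ z) × ∃[ t ] (IsCartesian (w ++ z) t × Tree U' (d + B) t))
chainTree zero lib n≤ [] = pure lib ([] , empty , cart-[] , none)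
chainTree zero lib n≤ (cons {pre = pre} {post = post} i [] refl refl) =
  pure lib (subst (λ y → All (_ ≤_) (y ++ post)) (sym (++-identityʳ pre)) (++⁺ lo≤pre lo≤post) , K empty ,
    subst (λ y → IsCartesian (y ++ post) (K empty)) (sym (++-identityʳ pre)) (cart [] cart-[]) ,
    Context.ended context)
  where open Item i
chainTree zero lib (s≤s ()) (cons _ (cons _ _ _ _) _ _)
chainTree {U} {B} {lo} {n} {w} {z} (suc d) lib n≤ c =
  -- This round costs twice the floor of n/2 and the recursion twice its ceiling, together exactly
  -- `2 * n`: all rounds stay linear.
  resize (≤-reflexive (trans (sym (*-distribˡ-+ 2 ⌊ n /2⌋ ⌈ n /2⌉)) (cong (2 *_) (⌊n/2⌋+⌈n/2⌉≡n n))))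
    (pairUp lib c >>= λ lib₁ e₁ c' →
     mapGrow (λ { _ (a , t , ct , to) → a , t , ct , weakenTree id (≤-reflexive (+-suc d B)) to })
       (chainTree d lib₁ half≤ c'))
  where
  half≤ : ⌈ n /2⌉ ≤ 2 ^ d
  half≤ = ≤-trans (⌈n/2⌉-mono n≤) (≤-reflexive
    (trans (cong (λ x → ⌈ 2 ^ d + x /2⌉) (+-identityʳ (2 ^ d))) (sym (n≡⌈n+n/2⌉ (2 ^ d)))))

-- The right spine below the root, one item per value in [lo, lo + k); dually the left spine.
data RightSpine (U : List TopTree) (B : ℕ) : ℕ → ℕ → List ℕ → Set where
  []   : ∀ {lo} → RightSpine U B lo 0 []
  skip : ∀ {lo k w} → RightSpine U B (suc lo) k w → RightSpine U B lo (suc k) w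
  cons : ∀ {lo k pre w w'} → Item U B lo lo pre [] → RightSpine U B (suc lo) k w → w' ≡ pre ++ w →
         RightSpine U B lo (suc k) w'

data LeftSpine (U : List TopTree) (B : ℕ) : ℕ → ℕ → List ℕ → Set where
  []   : ∀ {lo} → LeftSpine U B lo 0 []
  skip : ∀ {lo k w} → LeftSpine U B (suc lo) k w → LeftSpine U B lo (suc k) w
  cons : ∀ {lo k post w w'} → Item U B lo (suc lo) [] post → LeftSpine U B (suc lo) k w → w' ≡ w ++ post →
         LeftSpine U B lo (suc k) w'

-- `skip` passes over values below the minimum. `root` takes the leftmost minimum `lo`: the left
-- spine starts at `suc lo`, the right one at `lo`. Only nonempty strings have such a decomposition.
data Spines (U : List TopTree) (B : ℕ) : ℕ → ℕ → List ℕ → Set where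
  root : ∀ {lo k l r w} → LeftSpine U B (suc lo) k l → RightSpine U B lo (suc k) r → w ≡ l ++ lo ∷ r →
         Spines U B lo (suc k) w
  skip : ∀ {lo k w} → Spines U B (suc lo) k w → Spines U B lo (suc k) w

module _ {U U' : List TopTree} {B B' : ℕ} (e : U ⊆ U') (b : B ≤ B') where
  weakenRight : ∀ {lo k w} → RightSpine U B lo k w → RightSpine U' B' lo k w
  weakenRight []           = []
  weakenRight (skip s)     = skip (weakenRight s)
  weakenRight (cons i s q) = cons (weakenItem e b i) (weakenRight s) q

  weakenLeft : ∀ {lo k w} → LeftSpine U B lo k w → LeftSpine U' B' lo k w
  weakenLeft []           = []
  weakenLeft (skip s)     = skip (weakenLeft s)
  weakenLeft (cons i s q) = cons (weakenItem e b i) (weakenLeft s) q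

  weakenSpines : ∀ {lo k w} → Spines U B lo k w → Spines U' B' lo k w
  weakenSpines (root l r q) = root (weakenLeft l) (weakenRight r) q
  weakenSpines (skip s)     = skip (weakenSpines s)

noRight : ∀ {U B lo} k → RightSpine U B lo k []
noRight zero    = []
noRight (suc k) = skip (noRight k)

noLeft : ∀ {U B lo} k → LeftSpine U B lo k []
noLeft zero    = []
noLeft (suc k) = skip (noLeft k)

-- Equal values: the right-spine item comes from the earlier part of the string, so it stays above.
zigzag : ∀ {U B lo k w z} → RightSpine U B lo k w → LeftSpine U B lo k z →
         ∃[ n ] (n ≤ 2 * k × Chain U B lo n w z)
zigzag [] [] = 0 , z≤n , []
zigzag {k = suc k} r l with go r l
  where
  go : ∀ {U B lo k w z} → RightSpine U B lo (suc k) w → LeftSpine U B lo (suc k) z →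
       ∃[ n ] (n ≤ 2 + 2 * k × Chain U B lo n w z)
  go (skip r) (skip l) with zigzag r l
  ... | n , n≤ , c = n , m≤n⇒m≤o+n 2 n≤ , lowerChain (n≤1+n _) c
  go (cons {pre = pre} i r eq) (skip l) with zigzag r l
  ... | n , n≤ , c = suc n , s≤s (m≤n⇒m≤1+n n≤) , cons i (lowerChain (n≤1+n _) c) eq (sym (++-identityʳ _))
  go (skip r) (cons j l eq) with zigzag r l
  ... | n , n≤ , c = suc n , s≤s (m≤n⇒m≤1+n n≤) , cons j c refl eq
  go (cons i r eq) (cons j l eq') with zigzag r l
  ... | n , n≤ , c = 2 + n , s≤s (s≤s n≤) , cons i (cons j c refl eq') eq (sym (++-identityʳ _))
... | n , n≤ , c = n , ≤-trans n≤ (≤-reflexive (sym (*-suc 2 k))) , c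

-- The zigzag has at most `2 * k` items, which is at most `2 ^ suc d`: this gives `suc d` rounds and
-- `4 * k` nodes.
zigzagTree : ∀ {U B lo k w z} d → Library U → k ≤ 2 ^ d → RightSpine U B lo k w → LeftSpine U B lo k z →
  Grow (4 * k) U (λ U' → All (lo ≤_) (w ++ z) × ∃[ t ] (IsCartesian (w ++ z) t × Tree U' (suc (d + B)) t))
zigzagTree {k = k} d lib k≤ r l with zigzag r l
... | n , n≤ , c = resize (≤-trans (*-monoʳ-≤ 2 n≤) (≤-reflexive (sym (*-assoc 2 2 k))))
  (chainTree (suc d) lib (≤-trans n≤ (*-monoʳ-≤ 2 k≤)) c)

-- Concatenation of spine decompositions

-- Fusing the new item with an existing one of the same value keeps one item per value, so the
-- length of the spine is bounded by the alphabet and not by the string.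
pushRight : ∀ {U B lo k pre w} → Library U → Item U B lo lo pre [] → RightSpine U B lo (suc k) w →
            Grow 2 U (λ U' → RightSpine U' (suc B) lo (suc k) (pre ++ w))
pushRight lib i (skip s) = pure lib (cons (weakenItem id (n≤1+n _) i) (weakenRight id (n≤1+n _) s) refl)
pushRight {pre = pre} lib i (cons {pre = pre'} {w = w} j s refl) =
  mapGrow (λ e ij → cons ij (weakenRight e (n≤1+n _) s) (sym (++-assoc pre pre' w))) (composeItem lib i j)

budget-mono : ∀ k → 4 * k + 7 ≤ 4 * suc k + 7
budget-mono k = +-monoˡ-≤ 7 (*-monoʳ-≤ 4 (n≤1+n k))

-- Only one new item arises: the root of the second string, whose left subtree is formed by
-- the second left spine and the first right spine restricted to larger values.
joinRight : ∀ {U B lo k w z} d → Library U → k ≤ 2 ^ d → RightSpine U B lo k w → Spines U B lo k z →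
            Grow (4 * k + 7) U (λ U' → RightSpine U' (5 + (d + B)) lo k (w ++ z))
joinRight {B = B} {k = suc k} d lib k≤ (skip r) (skip s) =
  mapGrow (λ _ → skip) (resize (budget-mono k) (joinRight d lib (<⇒≤ k≤) r s))
joinRight {B = B} {k = suc k} {z = z} d lib k≤ (cons {pre = pre} {w = w} i r refl) (skip s) =
  mapGrow (λ e t → cons (weakenItem e (m≤n+m B (5 + d)) i) t (++-assoc pre w z))
    (resize (budget-mono k) (joinRight d lib (<⇒≤ k≤) r s))
joinRight {U} {B} {lo} {suc k} d lib k≤ x (root {l = l} {r = r} ls rs refl) = go x
  where
  step : ∀ {U' B' U''} → U ⊆ U' → U' ⊆ U'' → B ≤ B' → RightSpine U'' B' lo (suc k) r
  step e e' b = weakenRight (λ z → e' (e z)) b rs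
  -- Nodes: `4 * k` for the zigzag, 3 for the frame, 2 for fusing with the item of `rs` at `lo`;
  -- fusing in `go` brings 5 to 7. Height above `d + B`: 1 for the zigzag, 2 for the frame, 1 for
  -- each fusion, in all 5.
  base : ∀ {w} → RightSpine U B (suc lo) k w →
         Grow (4 * k + (3 + 2)) U (λ U' → RightSpine U' (4 + (d + B)) lo (suc k) ((w ++ l) ++ [ lo ] ++ r))
  base {w} xs =
    zigzagTree d lib (<⇒≤ k≤) xs ls >>= λ { lib₁ e₁ (lo<w , t , ct , to) →
    rightItem lib₁ lo<w ct to >>= λ lib₂ e₂ i →
    mapGrow (λ _ → subst (RightSpine _ _ _ _) (++-assoc (w ++ l) [ lo ] r))
      (pushRight lib₂ i (step e₁ e₂ (m≤n+m B (3 + d)))) }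
  go : ∀ {w} → RightSpine U B lo (suc k) w →
       Grow (4 * suc k + 7) U (λ U' → RightSpine U' (5 + (d + B)) lo (suc k) (w ++ l ++ lo ∷ r))
  go {w} (skip xs) =
    resize (≤-trans (+-monoʳ-≤ (4 * k) (m≤n+m 5 2)) (budget-mono k))
      (mapGrow (λ _ s → subst (RightSpine _ _ _ _) (++-assoc w l (lo ∷ r)) (weakenRight id (n≤1+n _) s)) (base xs))
  -- The first string has an item of value `lo` too. It stands earlier, so it goes outside the new
  -- one and is fused with it.
  go (cons {pre = pre} {w = w} i xs refl) =
    resize (≤-trans (≤-reflexive (+-assoc (4 * k) 5 2)) (budget-mono k))
      (base xs >>= λ lib₁ e₁ s →
       mapGrow (λ _ → subst (RightSpine _ _ _ _) eq) (pushRight lib₁ (weakenItem e₁ (m≤n+m B (4 + d)) i) s))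
    where
    eq : pre ++ (w ++ l) ++ [ lo ] ++ r ≡ (pre ++ w) ++ l ++ [ lo ] ++ r
    eq = solve (++-monoid ℕ)

-- Left-spine items below the minimum of the first string stay. The root of the first string becomes
-- the next item; the remaining items, ties included, stand later in the string and move into its
-- right subtree together with its right spine.
joinLeft : ∀ {U B lo k w z} d → Library U → k ≤ 2 ^ d → Spines U B lo k w → LeftSpine U B lo k z →
           Grow (4 * k + 7) U (λ U' → LeftSpine U' (5 + (d + B)) lo k (w ++ z))
joinLeft {k = suc k} d lib k≤ (skip s) (skip l) =
  mapGrow (λ _ → skip) (resize (budget-mono k) (joinLeft d lib (<⇒≤ k≤) s l))
joinLeft {B = B} {k = suc k} {w = w} d lib k≤ (skip s) (cons {post = post} {w = z} i l refl) =
  mapGrow (λ e t → cons (weakenItem e (m≤n+m B (5 + d)) i) t (sym (++-assoc w z post)))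
    (resize (budget-mono k) (joinLeft d lib (<⇒≤ k≤) s l))
joinLeft {U} {B} {lo} {suc k} {z = z} d lib k≤ (root {l = l} {r = r} ls rs refl) zs =
  resize (+-monoʳ-≤ (4 * suc k) (m≤n+m 3 4))
    (zigzagTree d lib k≤ rs zs >>= λ { lib₁ e₁ (lo≤w , t , ct , to) →
     mapGrow (λ e₂ i → cons (weakenItem id (m≤n+m (3 + (d + B)) 2) i)
               (weakenLeft (λ x → e₂ (e₁ x)) (m≤n+m B (5 + d)) ls) (++-assoc l (lo ∷ r) z))
       (leftItem lib₁ lo≤w ct to) })

concatenate : ∀ {U B lo k w z} d → Library U → k ≤ 2 ^ d → Spines U B lo k w → Spines U B lo k z →
              Grow (4 * k + 7) U (λ U' → Spines U' (5 + (d + B)) lo k (w ++ z))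
concatenate {k = suc k} d lib k≤ (skip s) (skip s') =
  mapGrow (λ _ → skip) (resize (budget-mono k) (concatenate d lib (<⇒≤ k≤) s s'))
-- Here the second string may have the same minimum: the earlier occurrence remains the root.
concatenate {B = B} {z = z} d lib k≤ (root {lo} {l = l} {r = r} ls rs refl) s' =
  mapGrow (λ e t → root (weakenLeft e (m≤n+m B (5 + d)) ls) t (++-assoc l (lo ∷ r) z)) (joinRight d lib k≤ rs s')
concatenate {B = B} {k = suc k} {w = w} d lib k≤ (skip s) (root {lo} {l = l} {r = r} ls rs refl) =
  mapGrow (λ e t → root t (weakenRight e (m≤n+m B (5 + d)) rs) (sym (++-assoc w l (lo ∷ r))))
    (resize (budget-mono k) (joinLeft d lib (<⇒≤ k≤) s ls))

-- Each spine is closed as a zigzag with an empty partner; `nodeTree` then adds the root with 3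
-- nodes and 2 levels.
spinesTree : ∀ {U B lo k w} d → Library U → k ≤ 2 ^ d → Spines U B lo k w →
             Grow (8 * k + 3) U (λ U' → ∃[ t ] (IsCartesian w t × Tree U' (3 + (d + B)) t))
spinesTree {k = suc k} d lib k≤ (skip s) =
  resize (+-monoˡ-≤ 3 (*-monoʳ-≤ 8 (n≤1+n k))) (spinesTree d lib (<⇒≤ k≤) s)
spinesTree {B = B} {lo} {suc k} d lib k≤ (root {l = l} {r = r} ls rs refl) =
  resize cost
    (zigzagTree d lib (<⇒≤ k≤) (noRight k) ls >>= λ { lib₁ e₁ (lo<l , tl , cl , tl') →
     zigzagTree d lib₁ k≤ (weakenRight e₁ ≤-refl rs) (noLeft (suc k)) >>= λ { lib₂ e₂ (lo≤r , tr , cr , tr') →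
     mapGrow (λ _ t → node tl tr ,
       cart-∷ lo<l (subst (All _) (++-identityʳ r) lo≤r) cl (subst (λ y → IsCartesian y tr) (++-identityʳ r) cr) , t)
       (nodeTree lib₂ (weakenTree e₂ ≤-refl tl') tr') } })
  where
  cost : 4 * k + (4 * suc k + 3) ≤ 8 * suc k + 3
  cost = ≤-trans (+-monoˡ-≤ (4 * suc k + 3) (*-monoʳ-≤ 4 (n≤1+n k)))
    (≤-reflexive (trans (sym (+-assoc (4 * suc k) _ 3)) (cong (_+ 3) (sym (*-distribʳ-+ (suc k) 4 4)))))

letter : ∀ {U B} lo k a → a < k → Spines U B lo k [ a + lo ]
letter lo (suc k) zero    _         = root (noLeft k) (noRight (suc k)) refl
letter {U} {B} lo (suc k) (suc a) (s≤s a<k) =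
  skip (subst (λ x → Spines U B (suc lo) k [ x ]) (+-suc a lo) (letter (suc lo) k a a<k))

-- Supplies the nonempty alphabet that absorbs additive constants in `size-bound`.
Spines-range : ∀ {U B lo k w} → Spines U B lo k w → 1 ≤ k
Spines-range (root _ _ _) = s≤s z≤n
Spines-range (skip _)     = s≤s z≤n

-- From library bounds to DAG size and depth

n≤2^⌈log₂n⌉ : ∀ n → n ≤ 2 ^ ⌈log₂ n ⌉
n≤2^⌈log₂n⌉ n = go n ⌈log₂ n ⌉ refl
  where
  go : ∀ n k → ⌈log₂ n ⌉ ≡ k → n ≤ 2 ^ k
  go 0             k       _  = z≤n
  go 1             zero    _  = ≤-refl
  go (suc (suc n)) zero    ()
  go n             (suc k) eq = begin
    n                           ≡⟨ ⌊n/2⌋+⌈n/2⌉≡n n ⟨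
    ⌊ n /2⌋ + ⌈ n /2⌉           ≤⟨ +-monoˡ-≤ _ (⌊n/2⌋≤⌈n/2⌉ n) ⟩
    ⌈ n /2⌉ + ⌈ n /2⌉           ≡⟨ cong (⌈ n /2⌉ +_) (+-identityʳ _) ⟨
    2 * ⌈ n /2⌉                 ≤⟨ *-monoʳ-≤ 2 (go ⌈ n /2⌉ k (trans (⌈log₂⌈n/2⌉⌉≡⌈log₂n⌉∸1 n) (cong pred eq))) ⟩
    2 ^ suc k                   ∎
    where open ≤-Reasoning

Unique-⊆⇒length≤ : ∀ {A : Set} {xs ys : List A} → Unique xs → xs ⊆ ys → length xs ≤ length ys
Unique-⊆⇒length≤ []           _   = z≤n
Unique-⊆⇒length≤ {xs = x ∷ xs} (x∉ ∷ u) sub with ∈-∃++ (sub (here refl))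
... | as , bs , refl = begin
  suc (length xs)         ≤⟨ s≤s (Unique-⊆⇒length≤ u sub') ⟩
  suc (length (as ++ bs)) ≡⟨ cong suc (length-++ as) ⟩
  suc (length as + length bs) ≡⟨ +-suc (length as) (length bs) ⟨
  length as + suc (length bs) ≡⟨ length-++ as ⟨
  length (as ++ x ∷ bs)   ∎
  where
  open ≤-Reasoning
  sub' : xs ⊆ as ++ bs
  sub' y∈ with ∈-++⁻ as (sub (there y∈))
  ... | inj₁ i            = ∈-++⁺ˡ i
  ... | inj₂ (here refl)  = ⊥-elim (All.lookup x∉ y∈ refl)
  ... | inj₂ (there i)    = ∈-++⁺ʳ as i

-- The library is closed under subtrees, so the distinct subtrees of `τ` all occur in `U` and its
-- length bounds the DAG size.
Tree⇒topTree : ∀ {U B t} → Library U → Tree U B t →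
               ∃[ τ ] (IsTopTreeOf t τ × dagSize τ ≤ length U × topDepth τ ≤ B)
Tree⇒topTree lib none   = nothing , (λ { ([] , L) () ; ([] , R) () ; (_ ∷ _ , _) () }) , z≤n , z≤n
Tree⇒topTree lib single =
  nothing , (λ { ([] , L) (inL ()) ; ([] , R) (inR ()) ; (L ∷ _ , _) (inL ()) ; (R ∷ _ , _) (inR ()) }) , z≤n , z≤n
Tree⇒topTree lib (big {τ = τ} _ (τ∈ , h≤) r) with r here
... | a , eq , top@(valid , region) =
  just τ ,
  (a , eq , ([] , nothing , valid) ,
    λ e → covers top e , All.lookup (Region.inside region)) ,
  Unique-⊆⇒length≤ (deduplicate-! (subtrees τ))
    (λ x∈ → Library.closed lib τ∈ (∈-deduplicate⁻ _≟T_ (subtrees τ) x∈)) ,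
  h≤

lookup-∷ʳ : ∀ {A B : Set} (P : A → B → Set) {m} {x y} (xs : Vec A m) (ys : Vec B m) →
  (∀ i → P (lookup xs i) (lookup ys i)) → P x y → ∀ i → P (lookup (xs ∷ʳᵥ x) i) (lookup (ys ∷ʳᵥ y) i)
lookup-∷ʳ P []ᵥ       []ᵥ       f p fzero    = p
lookup-∷ʳ P (_ ∷ᵥ _)  (_ ∷ᵥ _)  f p fzero    = f fzero
lookup-∷ʳ P (_ ∷ᵥ xs) (_ ∷ᵥ ys) f p (fsuc i) = lookup-∷ʳ P xs ys (λ j → f (fsuc j)) p i

-- Induction over the rules of the grammar

module _ {σ : ℕ} where
  Represented : List TopTree → List (Fin σ) → ℕ → Set
  Represented U w n = 1 ≤ n × Spines U (n * (6 * lg σ)) 0 σ (map toℕ w)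

  -- A concatenation adds `5 + ⌈log₂ σ ⌉` levels; as `lg σ` is at least 1, this fits into
  -- `6 * lg σ`, the allowance per level of the parse tree.
  depth-step : ∀ m n → 5 + (⌈log₂ σ ⌉ + (m ⊔ n) * (6 * lg σ)) ≤ suc (m ⊔ n) * (6 * lg σ)
  depth-step m n = begin
    5 + (⌈log₂ σ ⌉ + X)      ≡⟨ +-assoc 5 ⌈log₂ σ ⌉ X ⟨
    5 + ⌈log₂ σ ⌉ + X        ≤⟨ +-monoˡ-≤ X (+-monoʳ-≤ 5 (m≤m⊔n ⌈log₂ σ ⌉ 1)) ⟩
    5 + lg σ + X             ≤⟨ +-monoˡ-≤ X (+-monoˡ-≤ (lg σ) (*-monoʳ-≤ 5 (m≤n⊔m ⌈log₂ σ ⌉ 1))) ⟩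
    5 * lg σ + lg σ + X      ≡⟨ cong (_+ X) (+-comm (5 * lg σ) (lg σ)) ⟩
    6 * lg σ + X             ∎
    where
    open ≤-Reasoning
    X = (m ⊔ n) * (6 * lg σ)

  represent : ∀ {m} (G : SLP σ m) → Grow (m * (4 * σ + 7)) (eℓ ∷ er ∷ [])
    (λ U → ∀ i → Represented U (lookup (expansions G) i) (lookup (depths G) i))
  represent [] = pure base (λ ())
    where
    base : Library (eℓ ∷ er ∷ [])
    base = record
      { labels = λ { L → here refl ; R → there (here refl) }
      ; closed = λ { (here refl) (here refl) → here refl ; (there (here refl)) (here refl) → there (here refl) }
      }
  represent {suc m} (G ▹ term a) = resize (m≤n+m (m * (4 * σ + 7)) (4 * σ + 7)) (mapGrow
    (λ _ f → lookup-∷ʳ (Represented _) (expansions G) (depths G) f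
      (≤-refl , subst (λ x → Spines _ _ 0 σ [ x ]) (+-identityʳ (toℕ a)) (letter 0 σ (toℕ a) (toℕ<n a))))
    (represent G))
  represent {suc m} (G ▹ pair j k) = resize (≤-reflexive (+-comm (m * (4 * σ + 7)) _))
    (represent G >>= λ lib e f →
     mapGrow (λ e' s → lookup-∷ʳ (Represented _) (expansions G) (depths G)
         (λ i → proj₁ (f i) , weakenSpines e' ≤-refl (proj₂ (f i)))
         (s≤s z≤n , subst (Spines _ _ 0 σ) (sym (map-++ toℕ (lookup (expansions G) j) _))
           (weakenSpines id (depth-step (lookup (depths G) j) (lookup (depths G) k)) s)))
       -- Both operands are first raised to the height bound of the deeper one.
       (concatenate ⌈log₂ σ ⌉ lib (n≤2^⌈log₂n⌉ σ)
         (weakenSpines id (*-monoˡ-≤ (6 * lg σ) (m≤m⊔n (lookup (depths G) j) (lookup (depths G) k))) (proj₂ (f j)))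
         (weakenSpines id (*-monoˡ-≤ (6 * lg σ) (m≤n⊔m (lookup (depths G) j) (lookup (depths G) k))) (proj₂ (f k)))))

size-bound : ∀ m {σ} → 1 ≤ σ → 8 * σ + 3 + (suc m * (4 * σ + 7) + 2) ≤ 24 * suc m * σ
size-bound m {σ} 1≤σ = begin
  8 * σ + 3 + (suc m * (4 * σ + 7) + 2)
    ≤⟨ +-mono-≤ (+-monoʳ-≤ (8 * σ) (*-monoʳ-≤ 3 1≤σ))
         (+-mono-≤ (*-monoʳ-≤ (suc m) (+-monoʳ-≤ (4 * σ) (*-monoʳ-≤ 7 1≤σ))) (*-monoʳ-≤ 2 1≤σ)) ⟩
  -- The left side is `24 * σ + 11 * m * σ`, so `13 * m * σ` is exactly the slack. The summand
  -- `2 * σ` stems from the two initial nodes `eℓ` and `er`.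
  8 * σ + 3 * σ + (suc m * (4 * σ + 7 * σ) + 2 * σ) ≤⟨ m≤m+n _ (13 * m * σ) ⟩
  8 * σ + 3 * σ + (suc m * (4 * σ + 7 * σ) + 2 * σ) + 13 * m * σ ≡⟨ identity m σ ⟩
  24 * suc m * σ ∎
  where
  open ≤-Reasoning
  identity : ∀ m σ → 8 * σ + 3 * σ + (suc m * (4 * σ + 7 * σ) + 2 * σ) + 13 * m * σ ≡ 24 * suc m * σ
  identity = solve-∀

depth-bound : ∀ n σ → 1 ≤ n → 3 + (⌈log₂ σ ⌉ + n * (6 * lg σ)) ≤ 10 * n * lg σ
depth-bound n σ 1≤n = begin
  3 + (⌈log₂ σ ⌉ + n * (6 * g))  ≤⟨ +-mono-≤ (*-monoʳ-≤ 3 1≤g) (+-monoˡ-≤ _ (m≤m⊔n ⌈log₂ σ ⌉ 1)) ⟩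
  3 * g + (g + n * (6 * g))      ≡⟨ collect g n ⟩
  1 * (4 * g) + n * (6 * g)      ≤⟨ +-monoˡ-≤ _ (*-monoˡ-≤ (4 * g) 1≤n) ⟩
  n * (4 * g) + n * (6 * g)      ≡⟨ combine g n ⟩
  10 * n * g                     ∎
  where
  open ≤-Reasoning
  g = lg σ
  1≤g : 1 ≤ g
  1≤g = m≤n⊔m ⌈log₂ σ ⌉ 1
  collect : ∀ g n → 3 * g + (g + n * (6 * g)) ≡ 1 * (4 * g) + n * (6 * g)
  collect = solve-∀
  combine : ∀ g n → n * (4 * g) + n * (6 * g) ≡ 10 * n * g
  combine = solve-∀

theorem3 : ∃[ c₁ ] ∃[ c₂ ]
    (∀ (σ : ℕ) (S : List (Fin σ)) (C : BT) → IsCartesian (map toℕ S) C →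
    ∀ {m : ℕ} (𝒮 : SLP σ (suc m)) → generated 𝒮 ≡ S →
    ∃[ τ ] (IsTopTreeOf C τ ×
    dagSize τ ≤ c₁ * slpSize 𝒮 * σ ×
    topDepth τ ≤ c₂ * slpDepth 𝒮 * lg σ))
theorem3 = 24 , 10 , proof
  where
  proof : ∀ (σ : ℕ) (S : List (Fin σ)) (C : BT) → IsCartesian (map toℕ S) C →
    ∀ {m : ℕ} (𝒮 : SLP σ (suc m)) → generated 𝒮 ≡ S →
    ∃[ τ ] (IsTopTreeOf C τ × dagSize τ ≤ 24 * slpSize 𝒮 * σ × topDepth τ ≤ 10 * slpDepth 𝒮 * lg σ)
  proof σ S C cart {m} 𝒮 refl with represent 𝒮
  ... | grown lib _ size f with f (fromℕ m)
  ... | 1≤n , spines with spinesTree ⌈log₂ σ ⌉ lib (n≤2^⌈log₂n⌉ σ) spines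
  ... | grown lib' _ size' (t , cart' , tree) with Tree⇒topTree lib' tree
  ... | τ , isTop , dag≤ , depth≤ =
    -- The construction yields some Cartesian tree of the string; uniqueness identifies it with `C`.
    τ , subst (λ c → IsTopTreeOf c τ) (cartesian-unique refl cart' cart) isTop ,
    ≤-trans dag≤ (≤-trans size' (≤-trans (+-monoʳ-≤ _ size) (size-bound m (Spines-range spines)))) ,
    ≤-trans depth≤ (depth-bound (slpDepth 𝒮) σ 1≤n)
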